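{- Let $G$ be a weighted graph, let $x_1,x_2$ be distinct non-adjacent vertices of $G$, and let $c\neq 0$ be a real number. Then $$\det A(G) = \det A(G_{x_1+c\cdot x_2}).$$
   Context: A weighted graph $G$ is a triple $(V(G),E(G),w^G)$ where $(V(G),E(G))$ is a finite simple graph and $w^G$ is a real-valued symmetric weight function on all unordered pairs of distinct vertices such that $w^G(e)\neq 0$ if and only if $e\in E(G)$. By convention $w^G(aa)=0$ for every vertex $a$. The adjacency matrix $A(G)$ is indexed by $V(G)$, with $(a,b)$ entry $w^G(ab)$ for $a\ne b$ and $0$ on the diagonal. For distinct non-adjacent vertices $v,u$ of $G$ and a real number $c\neq 0$, the weighted graph $G_{v+c\cdot u}$ is defined by: $V(G_{v+c\cdot u})=V(G)$; for $b\neq v$, $w^{G_{v+c\cdot u}}(vb)=w^G(vb)+c\cdot w^G(bu)$; for distinct $a,b$ with $a\neq v\neq b$, $w^{G_{v+c\cdot u}}(ab)=w^G(ab)$; and $e\in E(G_{v+c\cdot u})$ if and only if $w^{G_{v+c\cdot u}}(e)\neq 0$. -}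

module Defs where

open import Algebra.Bundles.Raw using (RawRing)
import Algebra.Definitions.RawMonoid as RawMonoidDefinitions
import Algebra.Definitions.RawSemiring as RawSemiringDefinitions
open import Data.Fin.Base using (Fin; zero; suc; toℕ; punchIn)
import Data.Fin.Properties as Fin
open import Data.Nat.Base as ℕ using (ℕ; zero; suc; _⊔_)
import Data.Nat.Properties as ℕ
open import Data.Product.Base using (_×_; _,_; proj₁; proj₂; ∃-syntax)
open import Data.Rational.Base as ℚ
  using (ℚ; 0ℚ; 1ℚ; ½; ∣_∣; _<_; _≤_; 1/_; Positive; positive; nonNegative)
import Data.Rational.Properties as ℚ
open import Data.Rational.Solver using (module +-*-Solver)
open import Function.Bundles using (_↔_; _⇔_; mk⇔; module Inverse)
open import Function.Properties.Inverse using (↔⇒↣)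
open import Level using (0ℓ)
open import Relation.Binary.Definitions using (DecidableEquality)
open import Relation.Binary.PropositionalEquality
  using (_≡_; _≢_; refl; sym; trans; cong; cong₂; subst; ≢-sym)
open import Relation.Nullary using (¬_; yes; no; contradiction)
open import Relation.Nullary.Decidable using (via-injection)

------------------------------------------------------------------------
-- Real numbers: Cauchy sequences of rationals, with equality "the
-- difference tends to 0" and pointwise arithmetic.

IsCauchy : (ℕ → ℚ) → Set
IsCauchy x = ∀ ε → 0ℚ < ε →
  ∃[ N ] (∀ m n → N ℕ.≤ m → N ℕ.≤ n → ∣ x m ℚ.- x n ∣ < ε)

record ℝ : Set where
  constructor mkℝ
  field
    seq    : ℕ → ℚ
    cauchy : IsCauchy seq

open ℝ public

infix 4 _≈_ _≉_

record _≈_ (x y : ℝ) : Set where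
  constructor mk≈
  field
    tendsTo0 : ∀ ε → 0ℚ < ε →
      ∃[ N ] (∀ n → N ℕ.≤ n → ∣ seq x n ℚ.- seq y n ∣ < ε)

open _≈_ public

_≉_ : ℝ → ℝ → Set
x ≉ y = ¬ (x ≈ y)

≈-refl : ∀ {x} → x ≈ x
≈-refl {x} = mk≈ λ ε ε>0 → 0 , λ n _ →
  subst (λ q → ∣ q ∣ < ε) (sym (ℚ.+-inverseʳ (seq x n))) ε>0

≈-sym : ∀ {x y} → x ≈ y → y ≈ x
≈-sym {x} {y} x≈y = mk≈ λ ε ε>0 →
  let N , close = tendsTo0 x≈y ε ε>0
  in N , λ n N≤n → subst (_< ε) (flip-abs (seq x n) (seq y n)) (close n N≤n)
  where
  flip-abs : ∀ p q → ∣ p ℚ.- q ∣ ≡ ∣ q ℚ.- p ∣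
  flip-abs p q = trans (sym (ℚ.∣-p∣≡∣p∣ (p ℚ.- q))) (cong ∣_∣ (solve 2
    (λ a b → (:- (a :- b)) := (b :- a)) refl p q))
    where open +-*-Solver

fromℚ : ℚ → ℝ
fromℚ q = mkℝ (λ _ → q) λ ε ε>0 → 0 , λ _ _ _ _ →
  subst (λ r → ∣ r ∣ < ε) (sym (ℚ.+-inverseʳ q)) ε>0

½*-pos : ∀ {ε} → 0ℚ < ε → 0ℚ < ½ ℚ.* ε
½*-pos {ε} ε>0 = ℚ.positive⁻¹ (½ ℚ.* ε) {{ℚ.pos*pos⇒pos ½ ε {{positive ε>0}}}}

½+½ : ∀ ε → ½ ℚ.* ε ℚ.+ ½ ℚ.* ε ≡ ε
½+½ ε = trans (sym (ℚ.*-distribʳ-+ ε ½ ½)) (ℚ.*-identityˡ ε)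

∣+∣< : ∀ p q {ε δ} → ∣ p ∣ < ε → ∣ q ∣ < δ → ∣ p ℚ.+ q ∣ < ε ℚ.+ δ
∣+∣< p q p<ε q<δ = ℚ.≤-<-trans (ℚ.∣p+q∣≤∣p∣+∣q∣ p q) (ℚ.+-mono-< p<ε q<δ)

∣*∣< : ∀ p q {B δ} → Positive B → ∣ p ∣ ≤ B → ∣ q ∣ < δ → ∣ p ℚ.* q ∣ < B ℚ.* δ
∣*∣< p q {B} {δ} B>0 p≤B q<δ = begin-strict
  ∣ p ℚ.* q ∣      ≡⟨ ℚ.∣p*q∣≡∣p∣*∣q∣ p q ⟩
  ∣ p ∣ ℚ.* ∣ q ∣  ≤⟨ ℚ.*-monoʳ-≤-nonNeg ∣ q ∣ {{nonNegative (ℚ.0≤∣p∣ q)}} p≤B ⟩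
  B ℚ.* ∣ q ∣      <⟨ ℚ.*-monoʳ-<-pos B {{B>0}} q<δ ⟩
  B ℚ.* δ          ∎
  where open ℚ.≤-Reasoning

abstract
  +-cauchy : ∀ {x y} → IsCauchy x → IsCauchy y → IsCauchy (λ n → x n ℚ.+ y n)
  +-cauchy {x} {y} cx cy ε ε>0
    with cx (½ ℚ.* ε) (½*-pos ε>0) | cy (½ ℚ.* ε) (½*-pos ε>0)
  ... | N₁ , close₁ | N₂ , close₂ = N₁ ⊔ N₂ , λ m n N≤m N≤n →
    subst (λ q → ∣ q ∣ < ε) (rearrange (x m) (x n) (y m) (y n))
      (subst (_ <_) (½+½ ε) (∣+∣< (x m ℚ.- x n) (y m ℚ.- y n)
        (close₁ m n (ℕ.m⊔n≤o⇒m≤o N₁ N₂ N≤m) (ℕ.m⊔n≤o⇒m≤o N₁ N₂ N≤n))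
        (close₂ m n (ℕ.m⊔n≤o⇒n≤o N₁ N₂ N≤m) (ℕ.m⊔n≤o⇒n≤o N₁ N₂ N≤n))))
    where
    rearrange : ∀ a b c d → (a ℚ.- b) ℚ.+ (c ℚ.- d) ≡ (a ℚ.+ c) ℚ.- (b ℚ.+ d)
    rearrange = solve 4 (λ a b c d → ((a :- b) :+ (c :- d)) := ((a :+ c) :- (b :+ d))) refl
      where open +-*-Solver

  neg-cauchy : ∀ {x} → IsCauchy x → IsCauchy (λ n → ℚ.- x n)
  neg-cauchy {x} cx ε ε>0 with cx ε ε>0
  ... | N , close = N , λ m n N≤m N≤n →
    subst (λ q → ∣ q ∣ < ε) (rearrange (x n) (x m)) (close n m N≤n N≤m)
    where
    rearrange : ∀ a b → a ℚ.- b ≡ (ℚ.- b) ℚ.- (ℚ.- a)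
    rearrange = solve 2 (λ a b → (a :- b) := ((:- b) :- (:- a))) refl
      where open +-*-Solver

0<1 : 0ℚ < 1ℚ
0<1 = ℚ.positive⁻¹ 1ℚ

eventuallyBounded : ∀ {x} → IsCauchy x →
  ∃[ B ] ∃[ N ] (Positive B × (∀ n → N ℕ.≤ n → ∣ x n ∣ ≤ B))
eventuallyBounded {x} cx with cx 1ℚ 0<1
... | N , close = 1ℚ ℚ.+ ∣ x N ∣ , N , positive B>0 , bounded
  where
  B>0 : 0ℚ < 1ℚ ℚ.+ ∣ x N ∣
  B>0 = ℚ.+-mono-<-≤ 0<1 (ℚ.0≤∣p∣ (x N))

  open +-*-Solver

  bounded : ∀ n → N ℕ.≤ n → ∣ x n ∣ ≤ 1ℚ ℚ.+ ∣ x N ∣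
  bounded n N≤n = begin
    ∣ x n ∣
      ≡⟨ cong ∣_∣ (solve 2 (λ a b → a := ((a :- b) :+ b)) refl (x n) (x N)) ⟩
    ∣ (x n ℚ.- x N) ℚ.+ x N ∣
      ≤⟨ ℚ.∣p+q∣≤∣p∣+∣q∣ (x n ℚ.- x N) (x N) ⟩
    ∣ x n ℚ.- x N ∣ ℚ.+ ∣ x N ∣
      ≤⟨ ℚ.+-monoˡ-≤ ∣ x N ∣ (ℚ.<⇒≤ (close n N N≤n ℕ.≤-refl)) ⟩
    1ℚ ℚ.+ ∣ x N ∣ ∎
    where open ℚ.≤-Reasoning

shrink : ∀ B ε → Positive B → 0ℚ < ε → ∃[ δ ] (0ℚ < δ × B ℚ.* δ ≡ ½ ℚ.* ε)
shrink B ε B>0 ε>0 = 1/B ℚ.* (½ ℚ.* ε) , δ>0 ,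
  trans (sym (ℚ.*-assoc B 1/B (½ ℚ.* ε)))
    (trans (cong (ℚ._* (½ ℚ.* ε)) (ℚ.*-inverseʳ B {{ℚ.pos⇒nonZero B {{B>0}}}}))
           (ℚ.*-identityˡ (½ ℚ.* ε)))
  where
  1/B : ℚ
  1/B = (1/ B) {{ℚ.pos⇒nonZero B {{B>0}}}}

  δ>0 : 0ℚ < 1/B ℚ.* (½ ℚ.* ε)
  δ>0 = ℚ.positive⁻¹ (1/B ℚ.* (½ ℚ.* ε))
    {{ℚ.pos*pos⇒pos 1/B {{ℚ.1/pos⇒pos B {{B>0}}}} (½ ℚ.* ε) {{positive (½*-pos ε>0)}}}}

∣**∣< : ∀ a b c d {A B α β ε} → Positive A → Positive B →
  A ℚ.* α ≡ ½ ℚ.* ε → B ℚ.* β ≡ ½ ℚ.* ε →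
  ∣ a ∣ ≤ A → ∣ d ∣ ≤ B → ∣ c ℚ.- d ∣ < α → ∣ a ℚ.- b ∣ < β →
  ∣ a ℚ.* c ℚ.- b ℚ.* d ∣ < ε
∣**∣< a b c d {A} {B} {α} {β} {ε} A>0 B>0 Aα≡ Bβ≡ a≤A d≤B c-d<α a-b<β = begin-strict
  ∣ a ℚ.* c ℚ.- b ℚ.* d ∣
    ≡⟨ cong ∣_∣ (rearrange a b c d) ⟩
  ∣ a ℚ.* (c ℚ.- d) ℚ.+ d ℚ.* (a ℚ.- b) ∣
    <⟨ ∣+∣< (a ℚ.* (c ℚ.- d)) (d ℚ.* (a ℚ.- b))
         (∣*∣< a (c ℚ.- d) A>0 a≤A c-d<α) (∣*∣< d (a ℚ.- b) B>0 d≤B a-b<β) ⟩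
  A ℚ.* α ℚ.+ B ℚ.* β
    ≡⟨ cong₂ ℚ._+_ Aα≡ Bβ≡ ⟩
  ½ ℚ.* ε ℚ.+ ½ ℚ.* ε
    ≡⟨ ½+½ ε ⟩
  ε ∎
  where
  open ℚ.≤-Reasoning

  rearrange : ∀ a b c d →
    a ℚ.* c ℚ.- b ℚ.* d ≡ a ℚ.* (c ℚ.- d) ℚ.+ d ℚ.* (a ℚ.- b)
  rearrange = solve 4
    (λ a b c d → (a :* c :- b :* d) := (a :* (c :- d) :+ d :* (a :- b))) refl
    where open +-*-Solver

abstract
  *-cauchy : ∀ {x y} → IsCauchy x → IsCauchy y → IsCauchy (λ n → x n ℚ.* y n)
  *-cauchy {x} {y} cx cy ε ε>0 =
    let A , N₁ , A>0 , x≤A = eventuallyBounded cx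
        B , N₂ , B>0 , y≤B = eventuallyBounded cy
        α , α>0 , Aα≡      = shrink A ε A>0 ε>0
        β , β>0 , Bβ≡      = shrink B ε B>0 ε>0
        N₃ , close₃        = cy α α>0
        N₄ , close₄        = cx β β>0
        left : ∀ {k} → (N₁ ⊔ N₂) ⊔ (N₃ ⊔ N₄) ℕ.≤ k → N₁ ⊔ N₂ ℕ.≤ k
        left = ℕ.m⊔n≤o⇒m≤o (N₁ ⊔ N₂) (N₃ ⊔ N₄)
        right : ∀ {k} → (N₁ ⊔ N₂) ⊔ (N₃ ⊔ N₄) ℕ.≤ k → N₃ ⊔ N₄ ℕ.≤ k
        right = ℕ.m⊔n≤o⇒n≤o (N₁ ⊔ N₂) (N₃ ⊔ N₄)
    in (N₁ ⊔ N₂) ⊔ (N₃ ⊔ N₄) , λ m n N≤m N≤n →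
      ∣**∣< (x m) (x n) (y m) (y n) A>0 B>0 Aα≡ Bβ≡
        (x≤A m (ℕ.m⊔n≤o⇒m≤o N₁ N₂ (left N≤m)))
        (y≤B n (ℕ.m⊔n≤o⇒n≤o N₁ N₂ (left N≤n)))
        (close₃ m n (ℕ.m⊔n≤o⇒m≤o N₃ N₄ (right N≤m)) (ℕ.m⊔n≤o⇒m≤o N₃ N₄ (right N≤n)))
        (close₄ m n (ℕ.m⊔n≤o⇒n≤o N₃ N₄ (right N≤m)) (ℕ.m⊔n≤o⇒n≤o N₃ N₄ (right N≤n)))

≈-trans : ∀ {x y z} → x ≈ y → y ≈ z → x ≈ z
≈-trans {x} {y} {z} x≈y y≈z = mk≈ λ ε ε>0 →
  let N₁ , close₁ = tendsTo0 x≈y (½ ℚ.* ε) (½*-pos ε>0)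
      N₂ , close₂ = tendsTo0 y≈z (½ ℚ.* ε) (½*-pos ε>0)
  in N₁ ⊔ N₂ , λ n N≤n →
  subst (λ q → ∣ q ∣ < ε) (rearrange (seq x n) (seq y n) (seq z n))
    (subst (_ <_) (½+½ ε) (∣+∣< (seq x n ℚ.- seq y n) (seq y n ℚ.- seq z n)
      (close₁ n (ℕ.m⊔n≤o⇒m≤o N₁ N₂ N≤n)) (close₂ n (ℕ.m⊔n≤o⇒n≤o N₁ N₂ N≤n))))
  where
  rearrange : ∀ a b c → (a ℚ.- b) ℚ.+ (b ℚ.- c) ≡ a ℚ.- c
  rearrange = solve 3 (λ a b c → ((a :- b) :+ (b :- c)) := (a :- c)) refl
    where open +-*-Solver

infixl 6 _+_
infixl 7 _*_
infix  8 -_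

_+_ : ℝ → ℝ → ℝ
x + y = mkℝ (λ n → seq x n ℚ.+ seq y n) (+-cauchy {seq x} {seq y} (cauchy x) (cauchy y))

_*_ : ℝ → ℝ → ℝ
x * y = mkℝ (λ n → seq x n ℚ.* seq y n) (*-cauchy {seq x} {seq y} (cauchy x) (cauchy y))

-_ : ℝ → ℝ
- x = mkℝ (λ n → ℚ.- seq x n) (neg-cauchy {seq x} (cauchy x))

0ℝ 1ℝ : ℝ
0ℝ = fromℚ 0ℚ
1ℝ = fromℚ 1ℚ

ℝ-rawRing : RawRing 0ℓ 0ℓ
ℝ-rawRing = record
  { Carrier = ℝ ; _≈_ = _≈_ ; _+_ = _+_ ; _*_ = _*_ ; -_ = -_ ; 0# = 0ℝ ; 1# = 1ℝ }

open RawMonoidDefinitions (RawRing.+-rawMonoid ℝ-rawRing) public using (sum)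
open RawSemiringDefinitions (RawRing.rawSemiring ℝ-rawRing) public using (_^_)

------------------------------------------------------------------------
-- Determinants

Matrix : Set → Set
Matrix I = I → I → ℝ

-- Cofactor expansion along the first row.
detFin : ∀ n → Matrix (Fin n) → ℝ
detFin zero    M = 1ℝ
detFin (suc n) M = sum λ j →
  (- 1ℝ) ^ toℕ j * (M zero j * detFin n (λ i k → M (suc i) (punchIn j k)))

record Finite (I : Set) : Set where
  field
    size        : ℕ
    enumeration : I ↔ Fin size

  index : I → Fin size
  index = Inverse.to enumeration

  element : Fin size → I
  element = Inverse.from enumeration

  infix 4 _≟_
  _≟_ : DecidableEquality I
  _≟_ = via-injection (↔⇒↣ enumeration) Fin._≟_

-- Rows and columns are listed by the same enumeration, so the value does
-- not depend on which enumeration is chosen.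
det : ∀ {I} → Finite I → Matrix I → ℝ
det I-finite M = detFin size λ i j → M (element i) (element j)
  where open Finite I-finite

------------------------------------------------------------------------
-- Weighted graphs

record WeightedGraph : Set₁ where
  field
    V            : Set
    V-finite     : Finite V
    Adjacent     : V → V → Set
    adj-sym      : ∀ {a b} → Adjacent a b → Adjacent b a
    adj-irrefl   : ∀ {a} → ¬ Adjacent a a
    weight       : V → V → ℝ
    weight-sym   : ∀ {a b} → a ≢ b → weight a b ≈ weight b a
    weight-diag  : ∀ {a} → weight a a ≈ 0ℝ
    weight≉0⇔adj : ∀ {a b} → a ≢ b → weight a b ≉ 0ℝ ⇔ Adjacent a b

  open Finite V-finite public

adjacencyMatrix : (G : WeightedGraph) → Matrix (WeightedGraph.V G)
adjacencyMatrix G a b with WeightedGraph._≟_ G a b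
... | yes _ = 0ℝ
... | no  _ = WeightedGraph.weight G a b

-- addMultiple G v c u is the graph G_{v + c·u}.
module _ (G : WeightedGraph)
  (v : WeightedGraph.V G) (c : ℝ) (u : WeightedGraph.V G) where

  open WeightedGraph G

  addMultipleWeight : V → V → ℝ
  addMultipleWeight a b with a ≟ b | a ≟ v | b ≟ v
  ... | yes _ | _     | _     = 0ℝ
  ... | no _  | yes _ | _     = weight v b + c * weight b u
  ... | no _  | no _  | yes _ = weight v a + c * weight a u
  ... | no _  | no _  | no _  = weight a b

  private

    addMultipleWeight-sym : ∀ {a b} → a ≢ b →
      addMultipleWeight a b ≈ addMultipleWeight b a
    addMultipleWeight-sym {a} {b} a≢b with a ≟ b | b ≟ a | a ≟ v | b ≟ v
    ... | yes a≡b | _       | _       | _       = contradiction a≡b a≢b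
    ... | no _    | yes b≡a | _       | _       = contradiction (sym b≡a) a≢b
    ... | no _    | no _    | yes a≡v | yes b≡v = contradiction (trans a≡v (sym b≡v)) a≢b
    ... | no _    | no _    | yes _   | no _    = ≈-refl
    ... | no _    | no _    | no _    | yes _   = ≈-refl
    ... | no _    | no _    | no _    | no _    = weight-sym a≢b

    addMultipleWeight-diag : ∀ {a} → addMultipleWeight a a ≈ 0ℝ
    addMultipleWeight-diag {a} with a ≟ a
    ... | yes _  = ≈-refl
    ... | no a≢a = contradiction refl a≢a

  addMultiple : WeightedGraph
  addMultiple = record
    { V            = V
    ; V-finite     = V-finite
    ; Adjacent     = λ a b → a ≢ b × addMultipleWeight a b ≉ 0ℝ
    ; adj-sym      = λ {a} {b} (a≢b , w≉0) → ≢-sym a≢b , λ w≈0 →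
        w≉0 (≈-trans (addMultipleWeight-sym a≢b) w≈0)
    ; adj-irrefl   = λ (a≢a , _) → a≢a refl
    ; weight       = addMultipleWeight
    ; weight-sym   = addMultipleWeight-sym
    ; weight-diag  = addMultipleWeight-diag
    ; weight≉0⇔adj = λ a≢b → mk⇔ (a≢b ,_) proj₂
    }

{-# OPTIONS --safe #-}
module Submission where

-- The adjacency matrix of G_{x₁ + c·x₂} arises from A(G) by adding c times row
-- x₂ to row x₁ and then c times column x₂ to column x₁.  At (x₁ , x₁) these
-- operations produce a combination of w(x₁x₁), w(x₁x₂), w(x₂x₁) and w(x₂x₂),
-- which all vanish because x₁ and x₂ are not adjacent.

open import Algebra.Bundles using (CommutativeRing)
import Algebra.Properties.Ring as RingProperties
import Algebra.Properties.Semiring.Exp as SemiringExp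
import Algebra.Properties.Semiring.Sum as SemiringSum
import Algebra.Solver.Ring.NaturalCoefficients.Default as SemiringSolver
open import Data.Fin.Base as Fin using (Fin; zero; suc; toℕ; punchIn)
import Data.Fin.Properties as Fin
open import Data.Nat.Base as ℕ using (ℕ; zero; suc)
import Data.Nat.Properties as ℕ
open import Data.Product.Base using (_,_; ∃-syntax)
open import Data.Rational.Base as ℚ using (0ℚ; ½; ∣_∣; _<_)
import Data.Rational.Properties as ℚ
open import Data.Rational.Solver using (module +-*-Solver)
open import Data.Vec.Functional using (Vector)
open import Function.Base using (_∘_)
open import Function.Bundles using (module Equivalence; module Inverse)
open import Level using (0ℓ)
import Relation.Binary.Reasoning.Setoid as ≈-Reasoning
open import Relation.Binary.Definitions using (tri<; tri≈; tri>)
open import Relation.Binary.PropositionalEquality as ≡ using (_≡_; _≢_)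
open import Relation.Nullary using (¬_; yes; no; contradiction)

-- Determinants over a commutative ring.

module Determinant {c ℓ} (R : CommutativeRing c ℓ) where

  open CommutativeRing R hiding (zero)
  open RingProperties ring using (-1*x≈-x; -‿involutive)
  open SemiringExp semiring using (_^_)
  open SemiringSum semiring
  open SemiringSolver commutativeSemiring using (solve; _:=_; _:+_; _:*_; con)
  open ≈-Reasoning setoid

  Mat : ℕ → Set c
  Mat n = Fin n → Fin n → Carrier

  private variable
    n : ℕ

  sign : Fin n → Carrier
  sign j = (- 1#) ^ toℕ j

  minor : Fin (suc n) → Mat (suc n) → Mat n
  minor j M i k = M (suc i) (punchIn j k)

  -- The recursion of `detFin`, over an arbitrary commutative ring. The summand gets a name because
  -- the expansions below are compared term by term.
  determinant : ∀ n → Mat n → Carrier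
  cofactorTerm : Mat (suc n) → Vector Carrier (suc n)

  determinant zero    M = 1#
  determinant (suc n) M = sum (cofactorTerm M)

  cofactorTerm {n} M j = sign j * (M zero j * determinant n (minor j M))

  _ᵀ : Mat n → Mat n
  (M ᵀ) i j = M j i

  cofactorTerm-cong : (M N : Mat (suc n)) → ∀ j → M zero j ≈ N zero j →
    determinant n (minor j M) ≈ determinant n (minor j N) →
    cofactorTerm M j ≈ cofactorTerm N j
  cofactorTerm-cong M N j M₀≈N₀ minors = *-congˡ (*-cong M₀≈N₀ minors)

  cofactorTerm≈0 : (M : Mat (suc n)) → ∀ j →
    determinant n (minor j M) ≈ 0# → cofactorTerm M j ≈ 0#
  cofactorTerm≈0 M j minor≈0 =
    trans (*-congˡ (trans (*-congˡ minor≈0) (zeroʳ _))) (zeroʳ _)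

  determinant-cong : ∀ n {M N : Mat n} → (∀ i j → M i j ≈ N i j) →
    determinant n M ≈ determinant n N
  determinant-cong zero    M≈N = refl
  determinant-cong (suc n) {M} {N} M≈N = sum-cong-≋ λ j →
    cofactorTerm-cong M N j (M≈N zero j)
      (determinant-cong n λ i k → M≈N (suc i) (punchIn j k))

  -1*-1≈1 : - 1# * - 1# ≈ 1#
  -1*-1≈1 = trans (-1*x≈-x (- 1#)) (-‿involutive 1#)

  x+-1*x≈0 : ∀ x → x + - 1# * x ≈ 0#
  x+-1*x≈0 x = trans (+-congˡ (-1*x≈-x x)) (-‿inverseʳ x)

  sum≈0 : {f : Vector Carrier n} → (∀ i → f i ≈ 0#) → sum f ≈ 0#
  sum≈0 {n} f≈0 = trans (sum-cong-≋ f≈0) (sum-replicate-zero n)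

  -- Invariance of the determinant under transposition.

  innerMinor : Fin (suc n) → Fin (suc n) → Mat (suc (suc n)) → Mat n
  innerMinor i j M k l = M (suc (punchIn i k)) (suc (punchIn j l))

  -- The contribution of the entries `(zero , suc j)` and `(suc i , zero)` to a double expansion;
  -- the inner minor omits their two rows and two columns. It appears transposed because that is the
  -- form in which expanding a transposed minor produces it, by computation alone.
  doubleTerm : Mat (suc (suc n)) → Fin (suc n) → Fin (suc n) → Carrier
  doubleTerm {n} M j i = sign (suc j) *
    (M zero (suc j) * (sign i * (M (suc i) zero * determinant n (innerMinor i j M ᵀ))))

  -- The minor at column `suc j` still contains the first column of `M`. Transposing it, by
  -- invariance one size down, turns that column into a first row, along which the definition
  -- expands.
  cofactorTerm-expand : (∀ M → determinant (suc n) (M ᵀ) ≈ determinant (suc n) M) →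
    ∀ M j → cofactorTerm M (suc j) ≈ ∑[ i < suc n ] doubleTerm M j i
  cofactorTerm-expand {n} ᵀ-invariant M j = begin
    sign (suc j) * (M zero (suc j) * determinant (suc n) (minor (suc j) M))
      ≈⟨ *-congˡ (*-congˡ (ᵀ-invariant (minor (suc j) M))) ⟨
    sign (suc j) * (M zero (suc j) * determinant (suc n) (minor (suc j) M ᵀ))
      ≈⟨ *-congˡ (*-distribˡ-sum {suc n} (M zero (suc j)) (cofactorTerm (minor (suc j) M ᵀ))) ⟩
    sign (suc j) * sum (λ i → M zero (suc j) * cofactorTerm (minor (suc j) M ᵀ) i)
      ≈⟨ *-distribˡ-sum {suc n} (sign (suc j))
           (λ i → M zero (suc j) * cofactorTerm (minor (suc j) M ᵀ) i) ⟩
    ∑[ i < suc n ] doubleTerm M j i ∎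

  -- Both sides carry the sign (-1)^(i+j+1) and the same two entries; the inner minors differ by one
  -- transposition.
  doubleTerm-ᵀ : (∀ M → determinant n (M ᵀ) ≈ determinant n M) →
    ∀ M i j → doubleTerm {n} (M ᵀ) i j ≈ doubleTerm M j i
  doubleTerm-ᵀ ᵀ-invariant M i j = trans
    (solve 6 (λ e s t x y d →
      e :* s :* (x :* (t :* (y :* d))) := e :* t :* (y :* (s :* (x :* d))))
      refl (- 1#) (sign i) (sign j) (M (suc i) zero) (M zero (suc j)) _)
    (*-congˡ (*-congˡ (*-congˡ (*-congˡ (sym (ᵀ-invariant (innerMinor i j M)))))))

  -- Expanding along the first row, and then each minor that meets the first
  -- column along that column, is symmetric in rows and columns.
  determinant-ᵀ : ∀ n (M : Mat n) → determinant n (M ᵀ) ≈ determinant n M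
  determinant-ᵀ zero          M = refl
  determinant-ᵀ (suc zero)    M = refl
  determinant-ᵀ (suc (suc n)) M = +-cong
    (*-congˡ (*-congˡ (determinant-ᵀ (suc n) (minor zero M))))
    (begin
      sum (λ i → cofactorTerm (M ᵀ) (suc i))
        ≈⟨ sum-cong-≋ (cofactorTerm-expand (determinant-ᵀ (suc n)) (M ᵀ)) ⟩
      ∑[ i < suc n ] ∑[ j < suc n ] doubleTerm (M ᵀ) i j
        ≈⟨ ∑-comm (doubleTerm (M ᵀ)) ⟩
      ∑[ j < suc n ] ∑[ i < suc n ] doubleTerm (M ᵀ) i j
        ≈⟨ sum-cong-≋ (λ j → sum-cong-≋ (λ i → doubleTerm-ᵀ (determinant-ᵀ n) M i j)) ⟩
      ∑[ j < suc n ] ∑[ i < suc n ] doubleTerm M j i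
        ≈⟨ sum-cong-≋ (cofactorTerm-expand (determinant-ᵀ (suc n)) M) ⟨
      sum (λ j → cofactorTerm M (suc j)) ∎)

  -- Swapped and equal columns and rows.

  swap₀₁ : Fin (suc (suc n)) → Fin (suc (suc n))
  swap₀₁ zero          = suc zero
  swap₀₁ (suc zero)    = zero
  swap₀₁ (suc (suc k)) = suc (suc k)

  -- Along the first row, the terms of columns 0 and 1 trade places, and their signs are opposite.
  -- In every later term the minor has its own first two columns swapped, which the induction
  -- covers.
  determinant-swapColumns₀₁ : ∀ n (M : Mat (suc (suc n))) →
    determinant (suc (suc n)) (λ i j → M i (swap₀₁ j)) ≈
    - 1# * determinant (suc (suc n)) M
  determinant-swapColumns₀₁ n M = begin
    cofactorTerm N zero + (cofactorTerm N (suc zero) +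
      sum (λ j → cofactorTerm N (suc (suc j))))
      ≈⟨ +-cong term₀ (+-cong term₁ (trans (sum-cong-≋ (termₛ n M))
           (sym (*-distribˡ-sum {n} (- 1#) (λ j → cofactorTerm M (suc (suc j))))))) ⟩
    - 1# * cofactorTerm M (suc zero) + (- 1# * cofactorTerm M zero +
      - 1# * sum (λ j → cofactorTerm M (suc (suc j))))
      ≈⟨ solve 4 (λ e a b c → e :* b :+ (e :* a :+ e :* c) := e :* (a :+ (b :+ c)))
           refl (- 1#) (cofactorTerm M zero) (cofactorTerm M (suc zero)) _ ⟩
    - 1# * determinant (suc (suc n)) M ∎
    where
    N : Mat (suc (suc n))
    N i j = M i (swap₀₁ j)

    minor₀ : ∀ i k → minor zero N i k ≈ minor (suc zero) M i k
    minor₀ i zero    = refl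
    minor₀ i (suc k) = refl

    minor₁ : ∀ i k → minor (suc zero) N i k ≈ minor zero M i k
    minor₁ i zero    = refl
    minor₁ i (suc k) = refl

    term₀ : cofactorTerm N zero ≈ - 1# * cofactorTerm M (suc zero)
    term₀ = begin
      1# * x
        -- Of the two factors -1, one is pulled out in front and the other is the sign of column 1.
        ≈⟨ *-cong (sym -1*-1≈1) (*-congˡ (determinant-cong (suc n) minor₀)) ⟩
      - 1# * - 1# * y
        ≈⟨ solve 2 (λ e y → e :* e :* y := e :* (e :* con 1 :* y)) refl (- 1#) y ⟩
      - 1# * (- 1# * 1# * y) ∎
      where
      x = M zero (suc zero) * determinant (suc n) (minor zero N)
      y = M zero (suc zero) * determinant (suc n) (minor (suc zero) M)

    term₁ : cofactorTerm N (suc zero) ≈ - 1# * cofactorTerm M zero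
    term₁ = trans (*-assoc (- 1#) 1# _)
      (*-congˡ (*-congˡ (*-congˡ (determinant-cong (suc n) minor₁))))

    -- `n` and `M` are quantified anew so that `n` can be split: `j : Fin n` excludes `zero`, and
    -- the predecessor is the argument of the recursive call.
    termₛ : ∀ n (M : Mat (suc (suc n))) (j : Fin n) →
      cofactorTerm (λ i j → M i (swap₀₁ j)) (suc (suc j)) ≈
      - 1# * cofactorTerm M (suc (suc j))
    termₛ (suc n) M j = trans
      (*-congˡ (*-congˡ (trans (determinant-cong (suc (suc n)) minor-swap)
        (determinant-swapColumns₀₁ n (minor (suc (suc j)) M)))))
      (solve 4 (λ e s x d → s :* (x :* (e :* d)) := e :* (s :* (x :* d)))
        refl (- 1#) (sign (suc (suc j))) (M zero (suc (suc j))) _)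
      where
      minor-swap : ∀ i k → minor (suc (suc j)) (λ i j → M i (swap₀₁ j)) i k ≈
        minor (suc (suc j)) M i (swap₀₁ k)
      minor-swap i zero          = refl
      minor-swap i (suc zero)    = refl
      minor-swap i (suc (suc k)) = refl

  -- The first two cofactor terms cancel, and every later minor again has equal first columns. The
  -- swap rule alone would only give det = -det, which does not force det = 0 in an arbitrary
  -- commutative ring.
  determinant-equalColumns₀₁ : ∀ n (M : Mat (suc (suc n))) →
    (∀ i → M i zero ≈ M i (suc zero)) → determinant (suc (suc n)) M ≈ 0#
  determinant-equalColumns₀₁ n M M₀≈M₁ = begin
    cofactorTerm M zero + (cofactorTerm M (suc zero) +
      sum (λ j → cofactorTerm M (suc (suc j))))
      ≈⟨ +-congˡ (+-cong term₁ (sum≈0 (termₛ n M M₀≈M₁))) ⟩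
    cofactorTerm M zero + (- 1# * cofactorTerm M zero + 0#)
      ≈⟨ +-congˡ (+-identityʳ _) ⟩
    cofactorTerm M zero + - 1# * cofactorTerm M zero
      ≈⟨ x+-1*x≈0 _ ⟩
    0# ∎
    where
    minor₁ : ∀ i k → minor (suc zero) M i k ≈ minor zero M i k
    minor₁ i zero    = M₀≈M₁ (suc i)
    minor₁ i (suc k) = refl

    term₁ : cofactorTerm M (suc zero) ≈ - 1# * cofactorTerm M zero
    term₁ = trans (*-assoc (- 1#) 1# _)
      (*-congˡ (*-congˡ (*-cong (sym (M₀≈M₁ zero)) (determinant-cong (suc n) minor₁))))

    termₛ : ∀ n (M : Mat (suc (suc n))) → (∀ i → M i zero ≈ M i (suc zero)) →
      (j : Fin n) → cofactorTerm M (suc (suc j)) ≈ 0#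
    termₛ (suc n) M M₀≈M₁ j = cofactorTerm≈0 M (suc (suc j))
      (determinant-equalColumns₀₁ n (minor (suc (suc j)) M) (M₀≈M₁ ∘ suc))

  determinant-swapRows₀₁ : ∀ n (M : Mat (suc (suc n))) →
    determinant (suc (suc n)) (λ i j → M (swap₀₁ i) j) ≈
    - 1# * determinant (suc (suc n)) M
  determinant-swapRows₀₁ n M = begin
    determinant (suc (suc n)) (λ i j → M (swap₀₁ i) j)
      ≈⟨ determinant-ᵀ (suc (suc n)) (λ i j → M (swap₀₁ i) j) ⟨
    determinant (suc (suc n)) (λ i j → M (swap₀₁ j) i)
      ≈⟨ determinant-swapColumns₀₁ n (M ᵀ) ⟩
    - 1# * determinant (suc (suc n)) (M ᵀ)
      ≈⟨ *-congˡ (determinant-ᵀ (suc (suc n)) M) ⟩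
    - 1# * determinant (suc (suc n)) M ∎

  -- Rows 0 and 1 are handled by transposing. If both rows lie below the first, every minor inherits
  -- them. If the rows are 0 and at least 2, swapping rows 0 and 1 reduces to the previous
  -- situation.
  determinant-equalRows-< : ∀ n (M : Mat n) p q → p Fin.< q →
    (∀ j → M p j ≈ M q j) → determinant n M ≈ 0#
  determinant-equalRows-< (suc (suc n)) M zero (suc zero) p<q Mp≈Mq =
    trans (sym (determinant-ᵀ (suc (suc n)) M))
      (determinant-equalColumns₀₁ n (M ᵀ) Mp≈Mq)
  determinant-equalRows-< (suc (suc n)) M (suc p) (suc q) p<q Mp≈Mq = sum≈0 λ j →
    cofactorTerm≈0 M j
      (determinant-equalRows-< (suc n) (minor j M) p q (ℕ.s<s⁻¹ p<q)
        (λ k → Mp≈Mq (punchIn j k)))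
  determinant-equalRows-< (suc (suc (suc n))) M zero (suc (suc q)) p<q Mp≈Mq = begin
    determinant (suc (suc (suc n))) M
      ≈⟨ determinant-cong (suc (suc (suc n))) swap-swap ⟩
    determinant (suc (suc (suc n))) (λ i j → N (swap₀₁ i) j)
      ≈⟨ determinant-swapRows₀₁ (suc n) N ⟩
    - 1# * determinant (suc (suc (suc n))) N
      -- In `N` the former first row has index 1, so each minor has its equal rows at `zero` and
      -- `suc q`.
      ≈⟨ *-congˡ (sum≈0 λ j → cofactorTerm≈0 N j
           (determinant-equalRows-< (suc (suc n)) (minor j N) zero (suc q) ℕ.z<s
             (λ k → Mp≈Mq (punchIn j k)))) ⟩
    - 1# * 0#
      ≈⟨ zeroʳ _ ⟩
    0# ∎
    where
    N : Mat (suc (suc (suc n)))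
    N i j = M (swap₀₁ i) j

    swap-swap : ∀ i j → M i j ≈ N (swap₀₁ i) j
    swap-swap zero          j = refl
    swap-swap (suc zero)    j = refl
    swap-swap (suc (suc i)) j = refl

  determinant-equalRows : ∀ n (M : Mat n) p q → p ≢ q →
    (∀ j → M p j ≈ M q j) → determinant n M ≈ 0#
  determinant-equalRows n M p q p≢q Mp≈Mq with Fin.<-cmp p q
  ... | tri< p<q _ _ = determinant-equalRows-< n M p q p<q Mp≈Mq
  ... | tri≈ _ p≡q _ = contradiction p≡q p≢q
  ... | tri> _ _ q<p = determinant-equalRows-< n M q p q<p (sym ∘ Mp≈Mq)

  -- Linearity in a row, and row and column operations.

  determinant-rowLinear : ∀ n v c (L M N : Mat n) →
    (∀ j → L v j ≈ M v j + c * N v j) →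
    (∀ i → i ≢ v → ∀ j → L i j ≈ M i j) →
    (∀ i → i ≢ v → ∀ j → L i j ≈ N i j) →
    determinant n L ≈ determinant n M + c * determinant n N
  determinant-rowLinear (suc n) v c L M N Lv L≈M L≈N = begin
    sum (cofactorTerm L)
      ≈⟨ sum-cong-≋ (term v Lv L≈M L≈N) ⟩
    sum (λ j → cofactorTerm M j + c * cofactorTerm N j)
      ≈⟨ ∑-distrib-+ (cofactorTerm M) (λ j → c * cofactorTerm N j) ⟩
    sum (cofactorTerm M) + sum (λ j → c * cofactorTerm N j)
      ≈⟨ +-congˡ (*-distribˡ-sum c (cofactorTerm N)) ⟨
    sum (cofactorTerm M) + c * sum (cofactorTerm N) ∎
    where
    term : ∀ v →
      (∀ j → L v j ≈ M v j + c * N v j) →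
      (∀ i → i ≢ v → ∀ j → L i j ≈ M i j) →
      (∀ i → i ≢ v → ∀ j → L i j ≈ N i j) →
      ∀ j → cofactorTerm L j ≈ cofactorTerm M j + c * cofactorTerm N j
    -- Row `v` is the one expanded along: the minors of the three matrices agree, and each term is
    -- linear in its leading entry.
    term zero Lv L≈M L≈N j = begin
      s * (L zero j * l)
        ≈⟨ *-congˡ (*-congʳ (Lv j)) ⟩
      s * ((M zero j + c * N zero j) * l)
        ≈⟨ solve 5 (λ s x c y l →
             s :* ((x :+ c :* y) :* l) := s :* (x :* l) :+ c :* (s :* (y :* l)))
             refl s (M zero j) c (N zero j) l ⟩
      s * (M zero j * l) + c * (s * (N zero j * l))
        ≈⟨ +-cong
             (*-congˡ (*-congˡ (determinant-cong n
               λ i k → L≈M (suc i) (λ ()) (punchIn j k))))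
             (*-congˡ (*-congˡ (*-congˡ (determinant-cong n
               λ i k → L≈N (suc i) (λ ()) (punchIn j k))))) ⟩
      cofactorTerm M j + c * cofactorTerm N j ∎
      where
      s = sign j
      l = determinant n (minor j L)
    -- Row `v` lies inside the minors: the leading entries agree, and linearity of the minors is the
    -- induction hypothesis.
    term (suc v) Lv L≈M L≈N j = begin
      s * (L zero j * determinant n (minor j L))
        ≈⟨ *-congˡ (*-congˡ (determinant-rowLinear n v c
             (minor j L) (minor j M) (minor j N)
             (λ k → Lv (punchIn j k))
             (λ i i≢v k → L≈M (suc i) (i≢v ∘ Fin.suc-injective) (punchIn j k))
             (λ i i≢v k → L≈N (suc i) (i≢v ∘ Fin.suc-injective) (punchIn j k)))) ⟩
      s * (L zero j * (m + c * m′))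
        ≈⟨ solve 5 (λ s x c m m′ →
             s :* (x :* (m :+ c :* m′)) := s :* (x :* m) :+ c :* (s :* (x :* m′)))
             refl s (L zero j) c m m′ ⟩
      s * (L zero j * m) + c * (s * (L zero j * m′))
        ≈⟨ +-cong (*-congˡ (*-congʳ (L≈M zero (λ ()) j)))
             (*-congˡ (*-congˡ (*-congʳ (L≈N zero (λ ()) j)))) ⟩
      cofactorTerm M j + c * cofactorTerm N j ∎
      where
      s = sign j
      m = determinant n (minor j M)
      m′ = determinant n (minor j N)

  replaceRow : Fin n → Vector Carrier n → Mat n → Mat n
  replaceRow v r M i j with i Fin.≟ v
  ... | yes _ = r j
  ... | no  _ = M i j

  replaceRow-at : ∀ v r (M : Mat n) j → replaceRow v r M v j ≡ r j
  replaceRow-at v r M j with v Fin.≟ v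
  ... | yes _   = ≡.refl
  ... | no  v≢v = contradiction ≡.refl v≢v

  replaceRow-off : ∀ v r (M : Mat n) i → i ≢ v → ∀ j → replaceRow v r M i j ≡ M i j
  replaceRow-off v r M i i≢v j with i Fin.≟ v
  ... | yes i≡v = contradiction i≡v i≢v
  ... | no  _   = ≡.refl

  -- By linearity in row `v`, the change is `c` times the determinant of `M` with row `v` replaced
  -- by row `u`, a matrix with two equal rows.
  determinant-addRow : ∀ n v u c (M N : Mat n) → v ≢ u →
    (∀ j → N v j ≈ M v j + c * M u j) →
    (∀ i → i ≢ v → ∀ j → N i j ≈ M i j) →
    determinant n N ≈ determinant n M
  determinant-addRow n v u c M N v≢u Nv N≈M = begin
    determinant n N
      ≈⟨ determinant-rowLinear n v c N M K
           (λ j → trans (Nv j) (+-congˡ (*-congˡ (sym (reflexive (replaceRow-at v (M u) M j))))))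
           N≈M
           (λ i i≢v j → trans (N≈M i i≢v j) (sym (reflexive (replaceRow-off v (M u) M i i≢v j)))) ⟩
    determinant n M + c * determinant n K
      ≈⟨ +-congˡ (*-congˡ (determinant-equalRows n K v u v≢u λ j →
           reflexive (≡.trans (replaceRow-at v (M u) M j)
             (≡.sym (replaceRow-off v (M u) M u (v≢u ∘ ≡.sym) j))))) ⟩
    determinant n M + c * 0#
      ≈⟨ +-congˡ (zeroʳ c) ⟩
    determinant n M + 0#
      ≈⟨ +-identityʳ _ ⟩
    determinant n M ∎
    where
    K : Mat n
    K = replaceRow v (M u) M

  -- The row operation leads from `M` to `B`; the column operation from `B` to `N` is a row
  -- operation on the transposes. Since it acts on the updated row `v`, the corner entry gains `c`
  -- times the updated entry `(v , u)`.
  determinant-addRowAndColumn : ∀ n v u c (M N : Mat n) → v ≢ u →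
    N v v ≈ (M v v + c * M u v) + c * (M v u + c * M u u) →
    (∀ j → j ≢ v → N v j ≈ M v j + c * M u j) →
    (∀ i → i ≢ v → N i v ≈ M i v + c * M i u) →
    (∀ i j → i ≢ v → j ≢ v → N i j ≈ M i j) →
    determinant n N ≈ determinant n M
  determinant-addRowAndColumn n v u c M N v≢u Nvv Nvj Niv Nij = begin
    determinant n N
      ≈⟨ determinant-ᵀ n N ⟨
    determinant n (N ᵀ)
      ≈⟨ determinant-addRow n v u c (B ᵀ) (N ᵀ) v≢u column-v columns-off ⟩
    determinant n (B ᵀ)
      ≈⟨ determinant-ᵀ n B ⟩
    determinant n B
      ≈⟨ determinant-addRow n v u c M B v≢u B-at B-off ⟩
    determinant n M ∎
    where
    r : Vector Carrier n
    r j = M v j + c * M u j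

    B : Mat n
    B = replaceRow v r M

    B-at : ∀ j → B v j ≈ r j
    B-at j = reflexive (replaceRow-at v r M j)

    B-off : ∀ i → i ≢ v → ∀ j → B i j ≈ M i j
    B-off i i≢v j = reflexive (replaceRow-off v r M i i≢v j)

    column-v : ∀ i → N i v ≈ B i v + c * B i u
    -- Splitting on the test inside `replaceRow` makes row `i` of `B` compute, which turns the goals
    -- into the hypotheses on `N`.
    column-v i with i Fin.≟ v
    ... | yes ≡.refl = Nvv
    ... | no  i≢v    = Niv i i≢v

    columns-off : ∀ j → j ≢ v → ∀ i → N i j ≈ B i j
    columns-off j j≢v i with i Fin.≟ v
    ... | yes ≡.refl = Nvj j j≢v
    ... | no  i≢v    = Nij i j i≢v j≢v

-- The real numbers as a commutative ring.

open import Defs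

-- Arithmetic on `ℝ` is termwise, so this carries each ring law over from the rationals.
pointwise⇒≈ : ∀ {x y} → (∀ n → seq x n ≡ seq y n) → x ≈ y
pointwise⇒≈ {x} {y} x≡y = mk≈ λ ε ε>0 → 0 , λ n _ →
  ≡.subst (λ q → ∣ q ∣ < ε)
    (≡.sym (≡.trans (≡.cong (ℚ._- seq y n) (x≡y n)) (ℚ.+-inverseʳ (seq y n)))) ε>0

+-cong : ∀ {x x′ y y′} → x ≈ x′ → y ≈ y′ → x + y ≈ x′ + y′
+-cong {x} {x′} {y} {y′} x≈x′ y≈y′ = mk≈ λ ε ε>0 →
  let N₁ , close₁ = tendsTo0 x≈x′ (½ ℚ.* ε) (½*-pos ε>0)
      N₂ , close₂ = tendsTo0 y≈y′ (½ ℚ.* ε) (½*-pos ε>0)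
  in N₁ ℕ.⊔ N₂ , λ n N≤n →
  ≡.subst (λ q → ∣ q ∣ < ε) (rearrange (seq x n) (seq x′ n) (seq y n) (seq y′ n))
    (≡.subst (_ <_) (½+½ ε) (∣+∣< (seq x n ℚ.- seq x′ n) (seq y n ℚ.- seq y′ n)
      (close₁ n (ℕ.m⊔n≤o⇒m≤o N₁ N₂ N≤n)) (close₂ n (ℕ.m⊔n≤o⇒n≤o N₁ N₂ N≤n))))
  where
  rearrange : ∀ a b c d → (a ℚ.- b) ℚ.+ (c ℚ.- d) ≡ (a ℚ.+ c) ℚ.- (b ℚ.+ d)
  rearrange = solve 4 (λ a b c d → ((a :- b) :+ (c :- d)) := ((a :+ c) :- (b :+ d))) ≡.refl
    where open +-*-Solver

-‿cong : ∀ {x y} → x ≈ y → - x ≈ - y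
-‿cong {x} {y} x≈y = mk≈ λ ε ε>0 →
  let N , close = tendsTo0 (≈-sym x≈y) ε ε>0
  in N , λ n N≤n → ≡.subst (λ q → ∣ q ∣ < ε) (rearrange (seq y n) (seq x n)) (close n N≤n)
  where
  rearrange : ∀ a b → a ℚ.- b ≡ (ℚ.- b) ℚ.- (ℚ.- a)
  rearrange = solve 2 (λ a b → (a :- b) := ((:- b) :- (:- a))) ≡.refl
    where open +-*-Solver

-- From xy - x′y′ = x(y - y′) + y′(x - x′): only `x` and `y′` have to be bounded, and `α` and `β`
-- make each product smaller than ε/2.
*-cong : ∀ {x x′ y y′} → x ≈ x′ → y ≈ y′ → x * y ≈ x′ * y′
*-cong {x} {x′} {y} {y′} x≈x′ y≈y′ = mk≈ λ ε ε>0 →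
  let A , N₁ , A>0 , x≤A  = eventuallyBounded (cauchy x)
      B , N₂ , B>0 , y′≤B = eventuallyBounded (cauchy y′)
      α , α>0 , Aα≡       = shrink A ε A>0 ε>0
      β , β>0 , Bβ≡       = shrink B ε B>0 ε>0
      N₃ , close₃         = tendsTo0 y≈y′ α α>0
      N₄ , close₄         = tendsTo0 x≈x′ β β>0
      left : ∀ {k} → (N₁ ℕ.⊔ N₂) ℕ.⊔ (N₃ ℕ.⊔ N₄) ℕ.≤ k → N₁ ℕ.⊔ N₂ ℕ.≤ k
      left = ℕ.m⊔n≤o⇒m≤o (N₁ ℕ.⊔ N₂) (N₃ ℕ.⊔ N₄)
      right : ∀ {k} → (N₁ ℕ.⊔ N₂) ℕ.⊔ (N₃ ℕ.⊔ N₄) ℕ.≤ k → N₃ ℕ.⊔ N₄ ℕ.≤ k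
      right = ℕ.m⊔n≤o⇒n≤o (N₁ ℕ.⊔ N₂) (N₃ ℕ.⊔ N₄)
  in (N₁ ℕ.⊔ N₂) ℕ.⊔ (N₃ ℕ.⊔ N₄) , λ n N≤n →
    ∣**∣< (seq x n) (seq x′ n) (seq y n) (seq y′ n) A>0 B>0 Aα≡ Bβ≡
      (x≤A n (ℕ.m⊔n≤o⇒m≤o N₁ N₂ (left N≤n)))
      (y′≤B n (ℕ.m⊔n≤o⇒n≤o N₁ N₂ (left N≤n)))
      (close₃ n (ℕ.m⊔n≤o⇒m≤o N₃ N₄ (right N≤n)))
      (close₄ n (ℕ.m⊔n≤o⇒n≤o N₃ N₄ (right N≤n)))

ℝ-commutativeRing : CommutativeRing 0ℓ 0ℓ
ℝ-commutativeRing = record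
  { Carrier = ℝ ; _≈_ = _≈_ ; _+_ = _+_ ; _*_ = _*_ ; -_ = -_ ; 0# = 0ℝ ; 1# = 1ℝ
  ; isCommutativeRing = record
    { isRing = record
      { +-isAbelianGroup = record
        { isGroup = record
          { isMonoid = record
            { isSemigroup = record
              { isMagma = record
                { isEquivalence = record { refl = ≈-refl ; sym = ≈-sym ; trans = ≈-trans }
                ; ∙-cong = +-cong }
              ; assoc = λ x y z → pointwise⇒≈ λ n → ℚ.+-assoc (seq x n) (seq y n) (seq z n) }
            ; identity = (λ x → pointwise⇒≈ λ n → ℚ.+-identityˡ (seq x n))
                       , (λ x → pointwise⇒≈ λ n → ℚ.+-identityʳ (seq x n)) }
          ; inverse = (λ x → pointwise⇒≈ λ n → ℚ.+-inverseˡ (seq x n))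
                    , (λ x → pointwise⇒≈ λ n → ℚ.+-inverseʳ (seq x n))
          ; ⁻¹-cong = -‿cong }
        ; comm = λ x y → pointwise⇒≈ λ n → ℚ.+-comm (seq x n) (seq y n) }
      ; *-cong = *-cong
      ; *-assoc = λ x y z → pointwise⇒≈ λ n → ℚ.*-assoc (seq x n) (seq y n) (seq z n)
      ; *-identity = (λ x → pointwise⇒≈ λ n → ℚ.*-identityˡ (seq x n))
                   , (λ x → pointwise⇒≈ λ n → ℚ.*-identityʳ (seq x n))
      ; distrib = (λ x y z → pointwise⇒≈ λ n → ℚ.*-distribˡ-+ (seq x n) (seq y n) (seq z n))
                , (λ x y z → pointwise⇒≈ λ n → ℚ.*-distribʳ-+ (seq x n) (seq y n) (seq z n)) }
    ; *-comm = λ x y → pointwise⇒≈ λ n → ℚ.*-comm (seq x n) (seq y n) } }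

open CommutativeRing ℝ-commutativeRing
  using (*-congˡ; +-identityʳ; zeroʳ; setoid; semiring)
open Determinant ℝ-commutativeRing using (determinant; cofactorTerm; determinant-addRowAndColumn)

-- The two recursions agree clause by clause, but as separate functions they are identified at a
-- variable size only by induction.
detFin≈determinant : ∀ n M → detFin n M ≈ determinant n M
detFin≈determinant zero    M = ≈-refl
detFin≈determinant (suc n) M = sum-cong-≋ term
  where
  open SemiringSum semiring using (sum-cong-≋)

  term : ∀ j →
    (- 1ℝ) ^ toℕ j * (M zero j * detFin n (λ i k → M (suc i) (punchIn j k))) ≈
    cofactorTerm M j
  term j = *-congˡ {(- 1ℝ) ^ toℕ j} (*-congˡ {M zero j}
    (detFin≈determinant n λ i k → M (suc i) (punchIn j k)))

-- Far along the sequence, comparing a single rational term with ½ ε decides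
-- between |x| < ε and x ≉ 0.
≈0-stable : ∀ {x} → ¬ (x ≉ 0ℝ) → x ≈ 0ℝ
≈0-stable {x} ¬x≉0 = mk≈ λ ε ε>0 →
  let t>0 = ½*-pos ε>0 in close ε t>0 (½*-pos t>0) (cauchy x (½ ℚ.* (½ ℚ.* ε)) (½*-pos t>0))
  where
  open +-*-Solver

  close : ∀ ε (let t = ½ ℚ.* ε) → 0ℚ < t → 0ℚ < ½ ℚ.* t →
    ∃[ N ] (∀ m n → N ℕ.≤ m → N ℕ.≤ n → ∣ seq x m ℚ.- seq x n ∣ < ½ ℚ.* t) →
    ∃[ N ] (∀ n → N ℕ.≤ n → ∣ seq x n ℚ.- 0ℚ ∣ < ε)
  close ε t>0 δ>0 (N , near) with ∣ seq x N ∣ ℚ.<? ½ ℚ.* ε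
  ... | yes small = N , λ n N≤n →
    ≡.subst (λ q → ∣ q ∣ < ε)
      (solve 2 (λ a b → (a :- b) :+ b := a :- con 0ℚ) ≡.refl (seq x n) (seq x N))
      (≡.subst (_ <_) (½+½ ε)
        (∣+∣< (seq x n ℚ.- seq x N) (seq x N)
          (ℚ.<-trans (near n N N≤n ℕ.≤-refl) δ<t) small))
    where
    δ = ½ ℚ.* (½ ℚ.* ε)

    δ<t : δ < ½ ℚ.* ε
    δ<t = ≡.subst₂ _<_ (ℚ.+-identityʳ δ) (½+½ (½ ℚ.* ε)) (ℚ.+-monoʳ-< δ δ>0)
  ... | no large = contradiction x≉0 ¬x≉0
    where
    x≉0 : x ≉ 0ℝ
    x≉0 x≈0 =
      let N′ , x<δ = tendsTo0 x≈0 _ δ>0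
          n = N ℕ.⊔ N′
      in large (≡.subst (λ q → ∣ q ∣ < ½ ℚ.* ε)
        (solve 2 (λ a b → (b :- a) :+ (a :- con 0ℚ) := b) ≡.refl (seq x n) (seq x N))
        (≡.subst (∣ (seq x N ℚ.- seq x n) ℚ.+ (seq x n ℚ.- 0ℚ) ∣ <_) (½+½ (½ ℚ.* ε))
          (∣+∣< (seq x N ℚ.- seq x n) (seq x n ℚ.- 0ℚ)
            (near N n ℕ.≤-refl (ℕ.m≤m⊔n N N′)) (x<δ n (ℕ.m≤n⊔m N N′)))))

-- The adjacency matrix under the graph operation.

adjacencyMatrix≈weight : ∀ G a b → adjacencyMatrix G a b ≈ WeightedGraph.weight G a b
adjacencyMatrix≈weight G a b with WeightedGraph._≟_ G a b
-- On the diagonal the matrix is 0 by definition and the weight is 0 by convention.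
... | yes ≡.refl = ≈-sym (WeightedGraph.weight-diag G)
... | no  _      = ≈-refl

theorem1 : (G : WeightedGraph) → (x₁ x₂ : WeightedGraph.V G) → x₁ ≢ x₂ →
    ¬ WeightedGraph.Adjacent G x₁ x₂ → (c : ℝ) → c ≉ 0ℝ →
    det (WeightedGraph.V-finite G) (adjacencyMatrix G) ≈
    det (WeightedGraph.V-finite (addMultiple G x₁ c x₂)) (adjacencyMatrix (addMultiple G x₁ c x₂))
theorem1 G x₁ x₂ x₁≢x₂ ¬adj c _ = begin
  detFin size M
    ≈⟨ detFin≈determinant size M ⟩
  determinant size M
    ≈⟨ determinant-addRowAndColumn size v u c M N v≢u Nvv Nvj Niv Nij ⟨
  determinant size N
    ≈⟨ detFin≈determinant size N ⟨
  detFin size N ∎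
  where
  open WeightedGraph G
  open ≈-Reasoning setoid

  A A′ : Matrix V
  A  = adjacencyMatrix G
  A′ = adjacencyMatrix (addMultiple G x₁ c x₂)

  A≈weight : ∀ a b → A a b ≈ weight a b
  A≈weight = adjacencyMatrix≈weight G

  A′≈weight : ∀ a b → A′ a b ≈ addMultipleWeight G x₁ c x₂ a b
  A′≈weight = adjacencyMatrix≈weight (addMultiple G x₁ c x₂)

  -- Extends `weight-sym` to equal vertices, since `A′-row` applies it to `x₂` and a vertex `b` that
  -- may be `x₂`.
  weight-comm : ∀ a b → weight a b ≈ weight b a
  weight-comm a b with a ≟ b
  ... | yes ≡.refl = ≈-refl
  ... | no  a≢b    = weight-sym a≢b

  -- Non-adjacency only says that the weight cannot be apart from 0 in the sense of `≉`; `≈0-stable`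
  -- removes this double negation constructively.
  weight₁₂≈0 : weight x₁ x₂ ≈ 0ℝ
  weight₁₂≈0 = ≈0-stable λ w≉0 → ¬adj (Equivalence.to (weight≉0⇔adj x₁≢x₂) w≉0)

  -- The new weight is written with `weight b x₂`, whereas the row operation takes the entry at
  -- `(x₂ , b)`; symmetry reconciles them. For the column, the entry at `(a , x₁)` is the one to be
  -- flipped.
  A′-row : ∀ b → b ≢ x₁ → A′ x₁ b ≈ A x₁ b + c * A x₂ b
  A′-row b b≢x₁ = ≈-trans (A′≈weight x₁ b) (≈-trans weight′ (≈-sym (+-cong (A≈weight x₁ b)
    (*-congˡ (≈-trans (A≈weight x₂ b) (weight-comm x₂ b))))))
    where
    weight′ : addMultipleWeight G x₁ c x₂ x₁ b ≈ weight x₁ b + c * weight b x₂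
    weight′ with x₁ ≟ b | x₁ ≟ x₁
    ... | yes x₁≡b | _         = contradiction (≡.sym x₁≡b) b≢x₁
    ... | no  _    | yes _     = ≈-refl
    ... | no  _    | no  x₁≢x₁ = contradiction ≡.refl x₁≢x₁

  A′-column : ∀ a → a ≢ x₁ → A′ a x₁ ≈ A a x₁ + c * A a x₂
  A′-column a a≢x₁ = ≈-trans (A′≈weight a x₁) (≈-trans weight′ (≈-sym (+-cong
    (≈-trans (A≈weight a x₁) (weight-comm a x₁)) (*-congˡ (A≈weight a x₂)))))
    where
    weight′ : addMultipleWeight G x₁ c x₂ a x₁ ≈ weight x₁ a + c * weight a x₂
    weight′ with a ≟ x₁ | x₁ ≟ x₁
    ... | yes a≡x₁ | _         = contradiction a≡x₁ a≢x₁
    ... | no  _    | yes _     = ≈-refl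
    ... | no  _    | no  x₁≢x₁ = contradiction ≡.refl x₁≢x₁

  A′-diag : ∀ a → A′ a a ≈ 0ℝ
  A′-diag a = ≈-trans (A′≈weight a a) (WeightedGraph.weight-diag (addMultiple G x₁ c x₂))

  A′-off : ∀ a b → a ≢ x₁ → b ≢ x₁ → A′ a b ≈ A a b
  A′-off a b a≢x₁ b≢x₁ = ≈-trans (A′≈weight a b) weight′
    where
    weight′ : addMultipleWeight G x₁ c x₂ a b ≈ A a b
    weight′ with a ≟ b | a ≟ x₁ | b ≟ x₁
    ... | yes _ | _        | _        = ≈-refl
    ... | no  _ | yes a≡x₁ | _        = contradiction a≡x₁ a≢x₁
    ... | no  _ | no  _    | yes b≡x₁ = contradiction b≡x₁ b≢x₁
    ... | no  _ | no  _    | no  _    = ≈-refl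

  x+c*y≈0 : ∀ {x y} → x ≈ 0ℝ → y ≈ 0ℝ → x + c * y ≈ 0ℝ
  x+c*y≈0 x≈0 y≈0 = ≈-trans (+-cong x≈0 (≈-trans (*-congˡ y≈0) (zeroʳ c))) (+-identityʳ 0ℝ)

  corner≈0 : (A x₁ x₁ + c * A x₂ x₁) + c * (A x₁ x₂ + c * A x₂ x₂) ≈ 0ℝ
  corner≈0 = x+c*y≈0
    (x+c*y≈0 (≈-trans (A≈weight x₁ x₁) weight-diag)
      (≈-trans (A≈weight x₂ x₁) (≈-trans (weight-comm x₂ x₁) weight₁₂≈0)))
    (x+c*y≈0 (≈-trans (A≈weight x₁ x₂) weight₁₂≈0)
      (≈-trans (A≈weight x₂ x₂) weight-diag))

  M N : Matrix (Fin size)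
  M i j = A  (element i) (element j)
  N i j = A′ (element i) (element j)

  v u : Fin size
  v = index x₁
  u = index x₂

  element-index : ∀ a → element (index a) ≡ a
  element-index = Inverse.strictlyInverseʳ enumeration

  v≢u : v ≢ u
  v≢u v≡u = x₁≢x₂ (≡.trans (≡.sym (element-index x₁))
    (≡.trans (≡.cong element v≡u) (element-index x₂)))

  element≢x₁ : ∀ {i} → i ≢ v → element i ≢ x₁
  element≢x₁ {i} i≢v eᵢ≡x₁ = i≢v
    (≡.trans (≡.sym (Inverse.strictlyInverseˡ enumeration i)) (≡.cong index eᵢ≡x₁))

  Nvv : N v v ≈ (M v v + c * M u v) + c * (M v u + c * M u u)
  -- Entries of `M` and `N` in these positions are read at `element (index x₁)` and
  -- `element (index x₂)`; the rewrites restore the vertices.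
  Nvv rewrite element-index x₁ | element-index x₂ = ≈-trans (A′-diag x₁) (≈-sym corner≈0)

  Nvj : ∀ j → j ≢ v → N v j ≈ M v j + c * M u j
  Nvj j j≢v rewrite element-index x₁ | element-index x₂ =
    A′-row (element j) (element≢x₁ j≢v)

  Niv : ∀ i → i ≢ v → N i v ≈ M i v + c * M i u
  Niv i i≢v rewrite element-index x₁ | element-index x₂ =
    A′-column (element i) (element≢x₁ i≢v)

  Nij : ∀ i j → i ≢ v → j ≢ v → N i j ≈ M i j
  Nij i j i≢v j≢v = A′-off (element i) (element j) (element≢x₁ i≢v) (element≢x₁ j≢v)
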